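{- Let $r\ge 2$ and $m$ be integers with $3\le m\le 6$. Then for every integer $n\ge m-1$, $$F_{n+2,r}\equiv F_{n,r}\pmod{2^m},$$ i.e. from the term of index $m-1$ onward the sequence $(F_{n,r}\bmod 2^m)_{n\ge0}$ is periodic with period $2$.
   Context: For positive integers $r\le m\le n$, $S_r(n,m)$ denotes the $r$-Stirling number of the second kind: the number of partitions of $\{1,\dots,n\}$ into $m$ non-empty blocks such that $1,\dots,r$ lie in pairwise distinct blocks. For a positive integer $r$ and integer $n\ge 0$, the $r$-Fubini number is $F_{n,r}=\sum_{k=0}^{n}(k+r)!\,S_r(n+r,k+r)$. -}

module Defs where

open import Data.Fin.Base using (Fin; toℕ)
open import Data.Fin.Properties using (all?) renaming (_≟_ to _≟ᶠ_)
open import Data.Fin.Subset using (Subset; inside; outside; _∈_; _∩_; Nonempty; Empty)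
open import Data.Fin.Subset.Properties using (_∈?_; nonempty?)
open import Data.Integer.Base using (+_; _-_)
open import Data.Integer.Divisibility using (_∣_)
open import Data.List.Base using (List; []; _∷_; [_]; _++_; map; length; filter; upTo)
open import Data.List.Relation.Unary.All as All using (All)
open import Data.List.Relation.Unary.AllPairs as AllPairs using (AllPairs)
open import Data.List.Relation.Unary.Any as Any using (Any)
open import Data.Nat.Base using (ℕ; zero; suc; _+_; _*_; _<_; _!)
open import Data.Nat.ListAction using (sum)
open import Data.Nat.Properties using (_≟_; _<?_)
open import Data.Product.Base using (_×_)
import Data.Vec.Base as Vec
open import Relation.Binary.PropositionalEquality.Core using (_≡_; _≢_)
open import Relation.Nullary.Decidable.Core using (Dec; ¬?; _×-dec_; _→-dec_)
open import Relation.Nullary.Negation.Core using (¬_)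

-- Every subset of Fin n, each listed exactly once.
subsets : ∀ n → List (Subset n)
subsets zero    = [ Vec.[] ]
subsets (suc n) = map (outside Vec.∷_) (subsets n) ++ map (inside Vec.∷_) (subsets n)

sublists : ∀ {a} {A : Set a} → List A → List (List A)
sublists []       = [ [] ]
sublists (x ∷ xs) = sublists xs ++ map (x ∷_) (sublists xs)

-- A set of subsets of {1,…,n} is represented by the sublist of `subsets n`
-- consisting of its members; as `subsets n` has no repetitions, this
-- representation is unique.
families : ∀ n → List (List (Subset n))
families n = sublists (subsets n)

Disjoint : ∀ {n} → Subset n → Subset n → Set
Disjoint p q = Empty (p ∩ q)

Covers : ∀ {n} → List (Subset n) → Set
Covers {n} P = (x : Fin n) → Any (x ∈_) P

IsPartition : ∀ {n} → List (Subset n) → Set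
IsPartition P = All Nonempty P × AllPairs Disjoint P × Covers P

-- The element i of {1,…,n} is the x : Fin n with toℕ x = i - 1, so the
-- elements 1,…,r are those with toℕ x < r.
Separates : ∀ {n} → ℕ → List (Subset n) → Set
Separates {n} r P = (x y : Fin n) → toℕ x < r → toℕ y < r → x ≢ y →
                    All (λ B → ¬ (x ∈ B × y ∈ B)) P

IsRPartition : ∀ {n} → ℕ → ℕ → List (Subset n) → Set
IsRPartition r m P = IsPartition P × length P ≡ m × Separates r P

isPartition? : ∀ {n} (P : List (Subset n)) → Dec (IsPartition P)
isPartition? P = All.all? nonempty? P
           ×-dec AllPairs.allPairs? (λ p q → ¬? (nonempty? (p ∩ q))) P
           ×-dec all? (λ x → Any.any? (x ∈?_) P)

separates? : ∀ {n} r (P : List (Subset n)) → Dec (Separates r P)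
separates? r P = all? λ x → all? λ y →
  (toℕ x <? r) →-dec ((toℕ y <? r) →-dec (¬? (x ≟ᶠ y) →-dec
    All.all? (λ B → ¬? ((x ∈? B) ×-dec (y ∈? B))) P))

isRPartition? : ∀ {n} r m (P : List (Subset n)) → Dec (IsRPartition r m P)
isRPartition? r m P = isPartition? P ×-dec (length P ≟ m) ×-dec separates? r P

-- S_r(n,m)
rStirling₂ : (r n m : ℕ) → ℕ
rStirling₂ r n m = length (filter (isRPartition? r m) (families n))

-- F_{n,r}; `upTo (suc n)` is 0,…,n.
rFubini : (n r : ℕ) → ℕ
rFubini n r = sum (map (λ k → (k + r) ! * rStirling₂ r (n + r) (k + r)) (upTo (suc n)))

infix 4 _≡_[mod_]

_≡_[mod_] : ℕ → ℕ → ℕ → Set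
a ≡ b [mod d ] = + d ∣ + a - + b

{-# OPTIONS --safe #-}

-- Removing the last element of an r-partition gives the usual recurrence for
-- S_r.  Hence F_{n,r} = W(n,r), where W(0,k) = k! and
-- W(n+1,k) = k W(n,k) + W(n,k+1).  The differences W(n+2,k) − W(n,k) obey the
-- same linear recurrence in n, so if they vanish modulo 2^m for n = m − 1 and
-- all k ≥ 2, they vanish for all n ≥ m − 1.  For k ≥ 8 this holds since
-- 2^m ∣ 8!, and k = 2,…,7 is a finite computation.
module Submission where

open import Defs
open import Data.Empty using (⊥-elim)
open import Data.Fin.Base using (Fin; zero; suc; toℕ; fromℕ; fromℕ<; inject₁)
open import Data.Fin.Properties using (all?; toℕ-fromℕ; toℕ-fromℕ<; toℕ-inject₁; inject₁ℕ<; inject₁-injective; fromℕ≢inject₁)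
open import Data.Fin.Relation.Unary.Top using (view; ‵fromℕ; ‵inject₁)
open import Data.Fin.Subset using (Subset; Side; inside; outside; _∈_; _∉_; Nonempty) renaming (⊥ to ∅)
open import Data.Fin.Subset.Properties using (x∈p∩q⁺; x∈p∩q⁻; nonempty?; Empty-unique; ∉⊥)
import Data.Integer.Base as ℤ
import Data.Integer.Divisibility.Signed as ℤ
import Data.Integer.Properties as ℤ
open import Data.Integer.Tactic.RingSolver using (solve-∀)
open import Data.List.Base using (List; []; _∷_; [_]; _++_; map; length; filter; concatMap; applyUpTo)
import Data.List.Properties as List
open import Data.List.Membership.Propositional using (find; lose) renaming (_∈_ to _∈ˡ_)
open import Data.List.Membership.Propositional.Properties using (∈-++⁺ˡ; ∈-++⁺ʳ; ∈-++⁻; ∈-map⁺; ∈-map⁻; ∈-filter⁺; ∈-filter⁻; ∈-concatMap⁺; ∈-concatMap⁻)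
open import Data.List.Membership.Propositional.Properties.WithK using (unique∧set⇒bag)
open import Data.List.Relation.Binary.BagAndSetEquality using (∼bag⇒↭)
open import Data.List.Relation.Binary.Permutation.Propositional.Properties using (↭-length)
open import Data.List.Relation.Unary.All as All using (All; []; _∷_)
import Data.List.Relation.Unary.All.Properties as All
open import Data.List.Relation.Unary.AllPairs as AllPairs using (AllPairs; []; _∷_)
import Data.List.Relation.Unary.AllPairs.Properties as AllPairs
open import Data.List.Relation.Unary.Any as Any using (Any; here; there)
open import Data.List.Relation.Unary.Unique.Propositional using (Unique)
import Data.List.Relation.Unary.Unique.Propositional.Properties as Unique
open import Data.Nat.Base using (ℕ; zero; suc; _+_; _*_; _∸_; _^_; _!; _≤_; _<_; z≤n; s≤s; s≤s⁻¹)
open import Data.Nat.Divisibility using (_∣_; _∣?_; ∣-trans; ∣m∣n⇒∣m+n; ∣n⇒∣m*n; m≤n⇒m!∣n!)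
open import Data.Nat.ListAction using (sum)
open import Data.Nat.ListAction.Properties using (sum-++)
open import Data.Nat.Properties
open import Data.Nat.Solver using (module +-*-Solver)
open import Data.Product.Base using (_×_; _,_; proj₁; proj₂; ∃; ∃₂)
open import Data.Sum.Base using (_⊎_; inj₁; inj₂)
open import Data.Unit.Base using (tt)
open import Data.Vec.Base using ([]; _∷_; _∷ʳ_; initLast; here; there)
import Data.Vec.Properties as Vec
open import Function.Base using (_∘_)
open import Function.Bundles using (mk⇔)
open import Relation.Binary.PropositionalEquality using (_≡_; _≢_; _≗_; refl; sym; trans; cong; cong₂; subst; subst₂; ≢-sym; module ≡-Reasoning)
open import Relation.Nullary.Decidable.Core using (yes; no; toWitness)
open import Relation.Nullary.Negation.Core using (¬_; contradiction)

private
  variable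
    n : ℕ
    p q : Subset n
    a b : Side
    P : List (Subset n)
    Q : List (Subset (suc n))

-- Lexicographic order on subsets

infix 4 _⊏_

-- This is the order in which `subsets n` lists its entries. Hence the members of `families n` are
-- exactly the `_⊏_`-sorted lists, which gives every set of blocks one canonical form.
data _⊏_ : Subset n → Subset n → Set where
  head : (outside ∷ p) ⊏ (inside ∷ q)
  tail : p ⊏ q → (a ∷ p) ⊏ (a ∷ q)

⊏-irrefl : ¬ (p ⊏ p)
⊏-irrefl (tail p⊏p) = ⊏-irrefl p⊏p

⊏-asym : p ⊏ q → ¬ (q ⊏ p)
⊏-asym (tail p⊏q) (tail q⊏p) = ⊏-asym p⊏q q⊏p

⊏⇒nonempty : p ⊏ q → Nonempty q
⊏⇒nonempty head       = zero , here
⊏⇒nonempty (tail p⊏q) with x , x∈q ← ⊏⇒nonempty p⊏q = suc x , there x∈q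

∅⊏nonempty : Nonempty p → ∅ ⊏ p
∅⊏nonempty {p = inside  ∷ p} _                   = head
∅⊏nonempty {p = outside ∷ p} (suc x , there x∈p) = tail (∅⊏nonempty (x , x∈p))

⊏-∷ʳ⁺ : p ⊏ q → (p ∷ʳ a) ⊏ (q ∷ʳ b)
⊏-∷ʳ⁺ head       = head
⊏-∷ʳ⁺ (tail p⊏q) = tail (⊏-∷ʳ⁺ p⊏q)

-- The last coordinate is the least significant one and decides only between equal prefixes. So
-- deleting the last element keeps blocks in order, except that two of them may become equal.
⊏-∷ʳ⁻ : (p ∷ʳ a) ⊏ (q ∷ʳ b) → p ≡ q ⊎ p ⊏ q
⊏-∷ʳ⁻ {p = []}    {q = []}    _    = inj₁ refl
⊏-∷ʳ⁻ {p = _ ∷ _} {q = _ ∷ _} head = inj₂ head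
⊏-∷ʳ⁻ {p = _ ∷ _} {q = _ ∷ _} (tail p⊏q) with ⊏-∷ʳ⁻ p⊏q
... | inj₁ refl = inj₁ refl
... | inj₂ p⊏q′ = inj₂ (tail p⊏q′)

subsets-sorted : ∀ n → AllPairs _⊏_ (subsets n)
subsets-sorted zero    = [] ∷ []
subsets-sorted (suc n) = AllPairs.++⁺
  (AllPairs.map⁺ (AllPairs.map tail (subsets-sorted n)))
  (AllPairs.map⁺ (AllPairs.map tail (subsets-sorted n)))
  (All.map⁺ (All.universal (λ _ → All.map⁺ (All.universal (λ _ → head) _)) _))

∈-subsets : (p : Subset n) → p ∈ˡ subsets n
∈-subsets []            = here refl
∈-subsets (outside ∷ p) = ∈-++⁺ˡ (∈-map⁺ _ (∈-subsets p))
∈-subsets (inside  ∷ p) = ∈-++⁺ʳ _ (∈-map⁺ _ (∈-subsets p))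

-- Sublists

module _ {A : Set} where

  ∈-sublists⇒All : ∀ {S : A → Set} {xs ys} → All S xs → ys ∈ˡ sublists xs → All S ys
  ∈-sublists⇒All []                  (here refl) = []
  ∈-sublists⇒All {xs = x ∷ xs} (s ∷ ss) ys∈ with ∈-++⁻ (sublists xs) ys∈
  ... | inj₁ ys∈′ = ∈-sublists⇒All ss ys∈′
  ... | inj₂ ys∈′ with _ , zs∈ , refl ← ∈-map⁻ (x ∷_) ys∈′ = s ∷ ∈-sublists⇒All ss zs∈

  ∈-sublists⇒AllPairs : ∀ {R : A → A → Set} {xs ys} → AllPairs R xs → ys ∈ˡ sublists xs → AllPairs R ys
  ∈-sublists⇒AllPairs []                     (here refl) = []
  ∈-sublists⇒AllPairs {xs = x ∷ xs} (r ∷ rs) ys∈ with ∈-++⁻ (sublists xs) ys∈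
  ... | inj₁ ys∈′ = ∈-sublists⇒AllPairs rs ys∈′
  ... | inj₂ ys∈′ with _ , zs∈ , refl ← ∈-map⁻ (x ∷_) ys∈′ = ∈-sublists⇒All r zs∈ ∷ ∈-sublists⇒AllPairs rs zs∈

  -- The two halves of `sublists (x ∷ xs)` do not overlap, since only lists in the second half
  -- contain `x`.
  sublists-unique : {xs : List A} → Unique xs → Unique (sublists xs)
  sublists-unique []       = [] ∷ []
  sublists-unique {xs = x ∷ xs} (x≢ ∷ u) = Unique.++⁺ (sublists-unique u)
    (Unique.map⁺ List.∷-injectiveʳ (sublists-unique u)) disjoint
    where
    disjoint : ∀ {ys} → ¬ (ys ∈ˡ sublists xs × ys ∈ˡ map (x ∷_) (sublists xs))
    disjoint (ys∈ , ys∈′) with _ , _ , refl ← ∈-map⁻ (x ∷_) ys∈′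
      with x≢x ∷ _ ← ∈-sublists⇒All x≢ ys∈ = x≢x refl

  []∈sublists : (xs : List A) → [] ∈ˡ sublists xs
  []∈sublists []       = here refl
  []∈sublists (x ∷ xs) = ∈-++⁺ˡ ([]∈sublists xs)

  -- A head of `xs` that is not the head of `ys` precedes that head. By asymmetry it cannot occur
  -- later in `ys` either, so it can be left out.
  sorted⇒∈-sublists : ∀ {R : A → A → Set} → (∀ {x} → ¬ R x x) → (∀ {x y} → R x y → ¬ R y x) →
                      ∀ {xs ys} → AllPairs R xs → AllPairs R ys → All (_∈ˡ xs) ys → ys ∈ˡ sublists xs
  sorted⇒∈-sublists {R} irrefl asym = go
    where
    drop-∈ : ∀ {x xs ys} → All (x ≢_) ys → All (_∈ˡ x ∷ xs) ys → All (_∈ˡ xs) ys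
    drop-∈ []         []              = []
    drop-∈ (x≢x ∷ _)  (here refl ∷ _) = contradiction refl x≢x
    drop-∈ (_ ∷ x≢)   (there y∈ ∷ ∈s) = y∈ ∷ drop-∈ x≢ ∈s

    go : ∀ {xs ys} → AllPairs R xs → AllPairs R ys → All (_∈ˡ xs) ys → ys ∈ˡ sublists xs
    go {xs} _ [] _ = []∈sublists xs
    go {x ∷ xs} (_ ∷ rxs) (ry ∷ rys) (here refl ∷ ∈s) =
      ∈-++⁺ʳ (sublists xs) (∈-map⁺ (x ∷_)
        (go rxs rys (drop-∈ (All.map (λ { r refl → irrefl r }) ry) ∈s)))
    go {x ∷ xs} (rx ∷ rxs) (ry ∷ rys) (there y∈ ∷ ∈s) =
      ∈-++⁺ˡ (go rxs (ry ∷ rys) (y∈ ∷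
        drop-∈ (All.map (λ { r refl → asym r (All.lookup rx y∈) }) ry) ∈s))

families-unique : ∀ n → Unique (families n)
families-unique n = sublists-unique (AllPairs.map (λ { p⊏p refl → ⊏-irrefl p⊏p }) (subsets-sorted n))

∈-families⁻ : P ∈ˡ families n → AllPairs _⊏_ P
∈-families⁻ {n = n} = ∈-sublists⇒AllPairs (subsets-sorted n)

∈-families⁺ : AllPairs _⊏_ P → P ∈ˡ families n
∈-families⁺ {n = n} s = sorted⇒∈-sublists ⊏-irrefl ⊏-asym (subsets-sorted n) s (All.universal ∈-subsets _)

-- Appending a last element

∈-∷ʳ⁺ : ∀ {x} → x ∈ p → inject₁ x ∈ p ∷ʳ a
∈-∷ʳ⁺ here        = here
∈-∷ʳ⁺ (there x∈p) = there (∈-∷ʳ⁺ x∈p)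

∈-∷ʳ⁻ : ∀ {x} → inject₁ x ∈ p ∷ʳ a → x ∈ p
∈-∷ʳ⁻ {p = _ ∷ _} {x = zero}  here        = here
∈-∷ʳ⁻ {p = _ ∷ _} {x = suc _} (there x∈p) = there (∈-∷ʳ⁻ x∈p)

last∈∷ʳinside : (p : Subset n) → fromℕ n ∈ p ∷ʳ inside
last∈∷ʳinside []      = here
last∈∷ʳinside (_ ∷ p) = there (last∈∷ʳinside p)

last∉∷ʳoutside : (p : Subset n) → fromℕ n ∉ p ∷ʳ outside
last∉∷ʳoutside (_ ∷ p) (there l∈p) = last∉∷ʳoutside p l∈p

nonempty-∷ʳ⁺ : Nonempty p → Nonempty (p ∷ʳ a)
nonempty-∷ʳ⁺ (x , x∈p) = inject₁ x , ∈-∷ʳ⁺ x∈p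

nonempty-∷ʳoutside⁻ : Nonempty (p ∷ʳ outside) → Nonempty p
nonempty-∷ʳoutside⁻ {p = p} (x , x∈p) with view x
... | ‵fromℕ     = contradiction x∈p (last∉∷ʳoutside p)
... | ‵inject₁ y = y , ∈-∷ʳ⁻ x∈p

disjoint⁺ : (∀ {x} → x ∈ p → x ∉ q) → Disjoint p q
disjoint⁺ h (_ , x∈) with x∈p , x∈q ← x∈p∩q⁻ _ _ x∈ = h x∈p x∈q

disjoint⁻ : Disjoint p q → ∀ {x} → x ∈ p → x ∉ q
disjoint⁻ d x∈p x∈q = d (_ , x∈p∩q⁺ (x∈p , x∈q))

disjoint-∷ʳ⁻ : Disjoint (p ∷ʳ a) (q ∷ʳ b) → Disjoint p q
disjoint-∷ʳ⁻ d = disjoint⁺ λ x∈p x∈q → disjoint⁻ d (∈-∷ʳ⁺ x∈p) (∈-∷ʳ⁺ x∈q)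

disjoint-sym : Disjoint p q → Disjoint q p
disjoint-sym d = disjoint⁺ λ x∈q x∈p → disjoint⁻ d x∈p x∈q

disjoint-∷ʳoutside : Disjoint p q → Disjoint (p ∷ʳ a) (q ∷ʳ outside)
disjoint-∷ʳoutside {p = p} {q = q} {a = a} d = disjoint⁺ go
  where
  go : ∀ {x} → x ∈ p ∷ʳ a → x ∉ q ∷ʳ outside
  go {x} x∈p x∈q with view x
  ... | ‵fromℕ     = last∉∷ʳoutside q x∈q
  ... | ‵inject₁ y = disjoint⁻ d (∈-∷ʳ⁻ x∈p) (∈-∷ʳ⁻ x∈q)

-- `Marks outside P Q`: Q is P seen as a family on one more element;
-- `Marks inside P Q`: the new element is added to exactly one member of P.
data Marks {n} : Side → List (Subset n) → List (Subset (suc n)) → Set where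
  []   : Marks outside [] []
  skip : Marks b P Q → Marks b (p ∷ P) ((p ∷ʳ outside) ∷ Q)
  mark : Marks outside P Q → Marks inside (p ∷ P) ((p ∷ʳ inside) ∷ Q)

extend : List (Subset n) → List (Subset (suc n))
extend = map (_∷ʳ outside)

marks-extend : (P : List (Subset n)) → Marks outside P (extend P)
marks-extend []      = []
marks-extend (_ ∷ P) = skip (marks-extend P)

marks-outside : Marks outside P Q → Q ≡ extend P
marks-outside []       = refl
marks-outside (skip m) = cong (_ ∷_) (marks-outside m)

marks-length : Marks b P Q → length Q ≡ length P
marks-length []       = refl
marks-length (skip m) = cong suc (marks-length m)
marks-length (mark m) = cong suc (marks-length m)

marks-functional : ∀ {P P′ : List (Subset n)} → Marks a P Q → Marks b P′ Q → P ≡ P′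
marks-functional m m′ = go m m′ refl
  where
  -- Unification cannot invert `_∷ʳ_`, so the two derivations get separate indices `Q` and `Q′`
  -- joined by an equation.
  go : ∀ {P P′ : List (Subset n)} {Q Q′} → Marks a P Q → Marks b P′ Q′ → Q ≡ Q′ → P ≡ P′
  go-∷ : ∀ {p p′ : Subset n} {P P′ Q Q′} c d → Marks a P Q → Marks b P′ Q′ →
         (p ∷ʳ c) ∷ Q ≡ (p′ ∷ʳ d) ∷ Q′ → p ∷ P ≡ p′ ∷ P′
  go []       []        _  = refl
  go (skip m) (skip m′) eq = go-∷ outside outside m m′ eq
  go (skip m) (mark m′) eq = go-∷ outside inside m m′ eq
  go (mark m) (skip m′) eq = go-∷ inside outside m m′ eq
  go (mark m) (mark m′) eq = go-∷ inside inside m m′ eq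
  go-∷ _ _ m m′ eq =
    cong₂ _∷_ (Vec.∷ʳ-injectiveˡ _ _ (List.∷-injectiveˡ eq)) (go m m′ (List.∷-injectiveʳ eq))

marks-All⁺ : ∀ {S : Subset n → Set} {T : Subset (suc n) → Set} → (∀ {p a} → S p → T (p ∷ʳ a)) →
             Marks b P Q → All S P → All T Q
marks-All⁺ f []       []       = []
marks-All⁺ f (skip m) (s ∷ ss) = f s ∷ marks-All⁺ f m ss
marks-All⁺ f (mark m) (s ∷ ss) = f s ∷ marks-All⁺ f m ss

marks-All⁻ : ∀ {S : Subset n → Set} {T : Subset (suc n) → Set} → (∀ {p a} → T (p ∷ʳ a) → S p) →
             Marks b P Q → All T Q → All S P
marks-All⁻ f []       []       = []
marks-All⁻ f (skip m) (t ∷ ts) = f t ∷ marks-All⁻ f m ts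
marks-All⁻ f (mark m) (t ∷ ts) = f t ∷ marks-All⁻ f m ts

marks-Any⁺ : ∀ {S : Subset n → Set} {T : Subset (suc n) → Set} → (∀ {p a} → S p → T (p ∷ʳ a)) →
             Marks b P Q → Any S P → Any T Q
marks-Any⁺ f (skip m) (here s)  = here (f s)
marks-Any⁺ f (skip m) (there s) = there (marks-Any⁺ f m s)
marks-Any⁺ f (mark m) (here s)  = here (f s)
marks-Any⁺ f (mark m) (there s) = there (marks-Any⁺ f m s)

marks-Any⁻ : ∀ {S : Subset n → Set} {T : Subset (suc n) → Set} → (∀ {p a} → T (p ∷ʳ a) → S p) →
             Marks b P Q → Any T Q → Any S P
marks-Any⁻ f (skip m) (here t)  = here (f t)
marks-Any⁻ f (skip m) (there t) = there (marks-Any⁻ f m t)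
marks-Any⁻ f (mark m) (here t)  = here (f t)
marks-Any⁻ f (mark m) (there t) = there (marks-Any⁻ f m t)

marks-AllPairs⁻ : ∀ {R : Subset n → Subset n → Set} {S : Subset (suc n) → Subset (suc n) → Set} →
                  (∀ {p q a b} → S (p ∷ʳ a) (q ∷ʳ b) → R p q) →
                  Marks b P Q → AllPairs S Q → AllPairs R P
marks-AllPairs⁻ f []       []       = []
marks-AllPairs⁻ f (skip m) (s ∷ ss) = marks-All⁻ f m s ∷ marks-AllPairs⁻ f m ss
marks-AllPairs⁻ f (mark m) (s ∷ ss) = marks-All⁻ f m s ∷ marks-AllPairs⁻ f m ss

marks-sorted⁺ : Marks b P Q → AllPairs _⊏_ P → AllPairs _⊏_ Q
marks-sorted⁺ []       []       = []
marks-sorted⁺ (skip m) (s ∷ ss) = marks-All⁺ ⊏-∷ʳ⁺ m s ∷ marks-sorted⁺ m ss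
marks-sorted⁺ (mark m) (s ∷ ss) = marks-All⁺ ⊏-∷ʳ⁺ m s ∷ marks-sorted⁺ m ss

-- At most one block receives the new element, so of any two blocks at least one is extended by
-- `outside`.
marks-disjoint⁺ : Marks b P Q → AllPairs Disjoint P → AllPairs Disjoint Q
marks-disjoint⁺ []       []       = []
marks-disjoint⁺ (skip m) (d ∷ ds) =
  marks-All⁺ (disjoint-sym ∘ disjoint-∷ʳoutside ∘ disjoint-sym) m d ∷ marks-disjoint⁺ m ds
marks-disjoint⁺ (mark m) (d ∷ ds) with refl ← marks-outside m =
  All.map⁺ (All.map disjoint-∷ʳoutside d) ∷ marks-disjoint⁺ m ds

marks-inside⇒last : Marks {n} inside P Q → Any (fromℕ n ∈_) Q
marks-inside⇒last (skip m) = there (marks-inside⇒last m)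
marks-inside⇒last (mark m) = here (last∈∷ʳinside _)

marks-outside⇒¬last : Marks {n} outside P Q → ¬ Any (fromℕ n ∈_) Q
marks-outside⇒¬last (skip m) (here l∈)  = last∉∷ʳoutside _ l∈
marks-outside⇒¬last (skip m) (there l∈) = marks-outside⇒¬last m l∈

marks-covers⁺ : Marks inside P Q → Covers P → Covers Q
marks-covers⁺ m c x with view x
... | ‵fromℕ     = marks-inside⇒last m
... | ‵inject₁ y = marks-Any⁺ ∈-∷ʳ⁺ m (c y)

marks-covers⁻ : Marks b P Q → Covers Q → Covers P
marks-covers⁻ m c x = marks-Any⁻ ∈-∷ʳ⁻ m (c (inject₁ x))

marks-separates⁻ : ∀ {r} → Marks b P Q → Separates r Q → Separates r P
marks-separates⁻ m s x y x<r y<r x≢y = marks-All⁻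
  (λ ¬both (x∈ , y∈) → ¬both (∈-∷ʳ⁺ x∈ , ∈-∷ʳ⁺ y∈)) m
  (s (inject₁ x) (inject₁ y) (subst (_< _) (sym (toℕ-inject₁ x)) x<r)
     (subst (_< _) (sym (toℕ-inject₁ y)) y<r) (x≢y ∘ inject₁-injective))

-- Two blocks that both contain the last element would meet, so it lies in at most one of them.
disjoint⇒marks : (Q : List (Subset (suc n))) → AllPairs Disjoint Q → ∃₂ λ b P → Marks b P Q
disjoint⇒marks []      []       = _ , _ , []
disjoint⇒marks (q ∷ Q) (d ∷ ds) with initLast q | disjoint⇒marks Q ds
... | _ , outside , refl | _       , _ , m = _ , _ , skip m
... | _ , inside  , refl | outside , _ , m = _ , _ , mark m
... | p , inside  , refl | inside  , _ , m =
  contradiction (marks-inside⇒last m)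
    (All.All¬⇒¬Any (All.map (λ d → disjoint⁻ d (last∈∷ʳinside p)) d))

-- The new element joins a block that already has an element. Separation forbids this when both are
-- among the first `r`, which later forces `r ≤ n`.
marks-nonempty⇒last : Marks {n} inside P Q → All Nonempty P →
                      Any (λ q → fromℕ n ∈ q × ∃ λ x → inject₁ x ∈ q) Q
marks-nonempty⇒last (skip m) (_ ∷ ne)        = there (marks-nonempty⇒last m ne)
marks-nonempty⇒last (mark m) ((x , x∈p) ∷ _) = here (last∈∷ʳinside _ , x , ∈-∷ʳ⁺ x∈p)

-- The two ways to add a last element: joining a block or forming a new one

-- An enumeration of all `Q` with `Marks inside P Q`, one for each block of `P` that can receive the
-- new element.
insertions : List (Subset n) → List (List (Subset (suc n)))
insertions []      = []
insertions (p ∷ P) = ((p ∷ʳ inside) ∷ extend P) ∷ map ((p ∷ʳ outside) ∷_) (insertions P)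

length-insertions : (P : List (Subset n)) → length (insertions P) ≡ length P
length-insertions []      = refl
length-insertions (p ∷ P) = cong suc (trans (List.length-map _ (insertions P)) (length-insertions P))

∈-insertions⁺ : Marks inside P Q → Q ∈ˡ insertions P
∈-insertions⁺ (skip m) = there (∈-map⁺ _ (∈-insertions⁺ m))
∈-insertions⁺ (mark m) = here (cong (_ ∷_) (marks-outside m))

∈-insertions⁻ : Q ∈ˡ insertions P → Marks inside P Q
∈-insertions⁻ {P = p ∷ P} (here refl) = mark (marks-extend P)
∈-insertions⁻ {P = p ∷ P} (there Q∈) with _ , Q∈′ , refl ← ∈-map⁻ _ Q∈ = skip (∈-insertions⁻ Q∈′)

insertions-unique : (P : List (Subset n)) → Unique (insertions P)
insertions-unique []      = []
insertions-unique (p ∷ P) =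
  All.map⁺ (All.universal (λ _ eq → inside≢outside (Vec.∷ʳ-injectiveʳ p p (List.∷-injectiveˡ eq))) _)
  ∷ Unique.map⁺ List.∷-injectiveʳ (insertions-unique P)
  where
  inside≢outside : inside ≢ outside
  inside≢outside ()

-- The new block goes in front because it is lexicographically least among nonempty blocks extended
-- by `outside`.
addSingleton : List (Subset n) → List (Subset (suc n))
addSingleton P = (∅ ∷ʳ inside) ∷ extend P

-- Reading the singleton as the empty set with the last element inserted makes the facts about
-- `Marks` apply to new blocks too.
marks-addSingleton : (P : List (Subset n)) → Marks inside (∅ ∷ P) (addSingleton P)
marks-addSingleton P = mark (marks-extend P)

addSingleton-injective : ∀ {P P′ : List (Subset n)} → addSingleton P ≡ addSingleton P′ → P ≡ P′
addSingleton-injective eq =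
  List.∷-injectiveʳ (marks-functional (marks-addSingleton _) (subst (Marks _ _) (sym eq) (marks-addSingleton _)))

-- The recurrence for r-Stirling numbers

SortedRPartition : ℕ → ℕ → List (Subset n) → Set
SortedRPartition r m P = AllPairs _⊏_ P × IsRPartition r m P

-- The new element is alone in its block, so separation survives even when it is itself one of the
-- first `r`.
addSingleton⁺ : ∀ {r m} → SortedRPartition r m P → SortedRPartition r (suc m) (addSingleton P)
addSingleton⁺ {n} {P} {r} (sorted , (nonempty , disjoint , covers) , len , sep) =
  marks-sorted⁺ m (All.map ∅⊏nonempty nonempty ∷ sorted) ,
  ( (fromℕ n , last∈∷ʳinside ∅) ∷ All.map⁺ (All.map nonempty-∷ʳ⁺ nonempty)
  , marks-disjoint⁺ m (All.universal (λ _ → disjoint⁺ (⊥-elim ∘ ∉⊥)) _ ∷ disjoint)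
  , marks-covers⁺ m (there ∘ covers) ) ,
  cong suc (trans (marks-length (marks-extend P)) len) ,
  sep⁺
  where
  m = marks-addSingleton P
  sep⁺ : Separates r (addSingleton P)
  sep⁺ x y x<r y<r x≢y with view x | view y
  ... | ‵fromℕ | ‵fromℕ = contradiction refl x≢y
  ... | ‵fromℕ | ‵inject₁ y =
    (λ (_ , y∈) → ∉⊥ (∈-∷ʳ⁻ y∈)) ∷ All.map⁺ (All.universal (λ p (x∈ , _) → last∉∷ʳoutside p x∈) P)
  ... | ‵inject₁ x | ‵fromℕ =
    (λ (x∈ , _) → ∉⊥ (∈-∷ʳ⁻ x∈)) ∷ All.map⁺ (All.universal (λ p (_ , y∈) → last∉∷ʳoutside p y∈) P)
  ... | ‵inject₁ x | ‵inject₁ y =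
    (λ (x∈ , _) → ∉⊥ (∈-∷ʳ⁻ x∈)) ∷ All.map⁺ (All.map (λ ¬both (x∈ , y∈) → ¬both (∈-∷ʳ⁻ x∈ , ∈-∷ʳ⁻ y∈))
      (sep x y (subst (_< r) (toℕ-inject₁ x) x<r) (subst (_< r) (toℕ-inject₁ y) y<r) (x≢y ∘ cong inject₁)))

-- By `r ≤ n` the last element is not one of the first `r`, so it may join any block.
marks-inside⁺ : ∀ {r m} → r ≤ n → Marks {n} inside P Q → SortedRPartition r m P → SortedRPartition r m Q
marks-inside⁺ {n} {P} {Q} {r} r≤n m (sorted , (nonempty , disjoint , covers) , len , sep) =
  marks-sorted⁺ m sorted ,
  (marks-All⁺ nonempty-∷ʳ⁺ m nonempty , marks-disjoint⁺ m disjoint , marks-covers⁺ m covers) ,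
  trans (marks-length m) len ,
  sep⁺
  where
  last≮r : ¬ (toℕ (fromℕ n) < r)
  last≮r n<r = <⇒≱ (subst (_< r) (toℕ-fromℕ n) n<r) r≤n
  sep⁺ : Separates r Q
  sep⁺ x y x<r y<r x≢y with view x | view y
  ... | ‵fromℕ     | _          = contradiction x<r last≮r
  ... | ‵inject₁ x | ‵fromℕ     = contradiction y<r last≮r
  ... | ‵inject₁ x | ‵inject₁ y =
    marks-All⁺ (λ ¬both (x∈ , y∈) → ¬both (∈-∷ʳ⁻ x∈ , ∈-∷ʳ⁻ y∈)) m
      (sep x y (subst (_< r) (toℕ-inject₁ x) x<r) (subst (_< r) (toℕ-inject₁ y) y<r) (x≢y ∘ cong inject₁))

-- Equal nonempty blocks are not disjoint, so the equalities left open by `⊏-∷ʳ⁻` cannot occur.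
strictly-sorted : All Nonempty P → AllPairs Disjoint P → AllPairs (λ p q → p ≡ q ⊎ p ⊏ q) P → AllPairs _⊏_ P
strictly-sorted []             []       []       = []
strictly-sorted {P = p ∷ _} ((_ , x∈p) ∷ ne) (d ∷ ds) (s ∷ ss) =
  All.map (λ { (dis , inj₁ refl) → contradiction x∈p (disjoint⁻ dis x∈p) ; (_ , inj₂ p⊏q) → p⊏q }) (All.zip (d , s))
  ∷ strictly-sorted ne ds ss

-- Only the first block in lexicographic order can be the singleton of the
-- last element.
rPartition-cases : ∀ {r m} → SortedRPartition {suc n} r (suc m) Q →
  (∃ λ P → SortedRPartition r m P × Q ≡ addSingleton P) ⊎
  (∃ λ P → SortedRPartition r (suc m) P × r ≤ n × Marks inside P Q)
rPartition-cases {n} {Q} {r} (sorted , (nonempty , disjoint , covers) , len , sep)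
  with disjoint⇒marks Q disjoint
... | outside , P , m = contradiction (covers (fromℕ n)) (marks-outside⇒¬last m)
-- The cases differ in whether the first block becomes empty when the last element is deleted.
... | inside , p ∷ P , m = go (nonempty? p) m
  where
  disjointP : AllPairs Disjoint (p ∷ P)
  disjointP = marks-AllPairs⁻ disjoint-∷ʳ⁻ m disjoint
  sortedP : AllPairs (λ p q → p ≡ q ⊎ p ⊏ q) (p ∷ P)
  sortedP = marks-AllPairs⁻ ⊏-∷ʳ⁻ m sorted
  coversP : Covers (p ∷ P)
  coversP = marks-covers⁻ m covers
  sepP : Separates r (p ∷ P)
  sepP = marks-separates⁻ m sep
  lenP : length (p ∷ P) ≡ suc _
  lenP = trans (sym (marks-length m)) len

  go : _ → Marks inside (p ∷ P) Q → _
  go (yes ne) _ = inj₂ (p ∷ P , (strictly-sorted nonemptyP disjointP sortedP ,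
      (nonemptyP , disjointP , coversP) , lenP , sepP) , r≤n , m)
    where
    nonemptyP : All Nonempty (p ∷ P)
    -- Every later block equals the nonempty `p` or lies above it, and nothing above another subset
    -- is empty.
    nonemptyP = ne ∷ All.map (λ { (inj₁ refl) → ne ; (inj₂ p⊏q) → ⊏⇒nonempty p⊏q }) (AllPairs.head sortedP)
    r≤n : r ≤ n
    r≤n with r ≤? n
    ... | yes r≤n = r≤n
    ... | no  r≰n = contradiction (marks-nonempty⇒last m nonemptyP) (All.All¬⇒¬Any (All.tabulate ¬both))
      where
      ¬both : ∀ {q} → q ∈ˡ Q → ¬ (fromℕ n ∈ q × ∃ λ x → inject₁ x ∈ q)
      ¬both q∈Q (l∈q , x , x∈q) =
        -- If `n < r`, the last element and its companion are distinct elements among the first `r`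
        -- that share a block.
        All.lookup (sep (fromℕ n) (inject₁ x) (subst (_< r) (sym (toℕ-fromℕ n)) (≰⇒> r≰n))
          (<-trans (inject₁ℕ< x) (≰⇒> r≰n)) fromℕ≢inject₁) q∈Q (l∈q , x∈q)
  go (no empty) (skip _) = contradiction (nonempty-∷ʳoutside⁻ (All.head nonempty)) empty
  -- Here the first block is the singleton of the last element. The other blocks omit that element,
  -- so they stay nonempty and cover the rest.
  go (no empty) (mark m′) with refl ← Empty-unique empty | refl ← marks-outside m′ =
    inj₁ (P , (strictly-sorted nonemptyP (AllPairs.tail disjointP) (AllPairs.tail sortedP) ,
      (nonemptyP , AllPairs.tail disjointP , Any.tail ∉⊥ ∘ coversP) ,
      suc-injective lenP , λ x y x<r y<r x≢y → All.tail (sepP x y x<r y<r x≢y)) , refl)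
    where
    nonemptyP : All Nonempty P
    nonemptyP = All.map nonempty-∷ʳoutside⁻ (All.map⁻ (All.tail nonempty))

-- Counting r-partitions by comparing duplicate-free lists

rPartitions : ∀ r n m → List (List (Subset n))
rPartitions r n m = filter (isRPartition? r m) (families n)

∈-rPartitions⁺ : ∀ {r m} → SortedRPartition {n} r m P → P ∈ˡ rPartitions r n m
∈-rPartitions⁺ {r = r} {m} (sorted , part) = ∈-filter⁺ (isRPartition? r m) (∈-families⁺ sorted) part

∈-rPartitions⁻ : ∀ {r m} → P ∈ˡ rPartitions r n m → SortedRPartition {n} r m P
∈-rPartitions⁻ {n = n} {r = r} {m} P∈ with P∈f , part ← ∈-filter⁻ (isRPartition? r m) {xs = families n} P∈ = ∈-families⁻ P∈f , part

rPartitions-unique : ∀ r n m → Unique (rPartitions r n m)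
rPartitions-unique r n m = Unique.filter⁺ (isRPartition? r m) (families-unique n)

-- Duplicate-free lists with the same members are permutations of each other, so two mutual
-- inclusions replace an explicit bijection.
unique⇒length : ∀ {A : Set} {xs ys : List A} → Unique xs → Unique ys →
                (∀ {z} → z ∈ˡ xs → z ∈ˡ ys) → (∀ {z} → z ∈ˡ ys → z ∈ˡ xs) → length xs ≡ length ys
unique⇒length u v f g = ↭-length (∼bag⇒↭ (unique∧set⇒bag u v (mk⇔ f g)))

concatMap-unique : ∀ {A B : Set} {f : A → List B} {xs} → (∀ x → Unique (f x)) →
                   (∀ {x y z} → z ∈ˡ f x → z ∈ˡ f y → x ≡ y) → Unique xs → Unique (concatMap f xs)
concatMap-unique {f = f} u inj v = Unique.concat⁺ (All.map⁺ (All.universal u _))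
  (AllPairs.map⁺ (AllPairs.map disjoint v))
  where
  disjoint : ∀ {x y} → x ≢ y → ∀ {z} → ¬ (z ∈ˡ f x × z ∈ˡ f y)
  disjoint x≢y (z∈x , z∈y) = x≢y (inj z∈x z∈y)

length-concatMap : ∀ {A B : Set} {f : A → List B} {c xs} → All (λ x → length (f x) ≡ c) xs →
                   length (concatMap f xs) ≡ length xs * c
length-concatMap []                           = refl
length-concatMap {f = f} {xs = x ∷ xs} (e ∷ es) =
  trans (List.length-++ (f x)) (cong₂ _+_ e (length-concatMap es))

-- All `suc n` elements are among the separated ones, so the last can only form a block of its own.
rStirling₂-< : ∀ r n m → n < r → rStirling₂ r (suc n) (suc m) ≡ rStirling₂ r n m
rStirling₂-< r n m n<r = trans
  (unique⇒length (rPartitions-unique r (suc n) (suc m))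
    (Unique.map⁺ addSingleton-injective (rPartitions-unique r n m)) to from)
  (List.length-map addSingleton (rPartitions r n m))
  where
  to : ∀ {Q} → Q ∈ˡ rPartitions r (suc n) (suc m) → Q ∈ˡ map addSingleton (rPartitions r n m)
  to Q∈ with rPartition-cases (∈-rPartitions⁻ Q∈)
  ... | inj₁ (P , valid , refl)     = ∈-map⁺ addSingleton (∈-rPartitions⁺ valid)
  ... | inj₂ (_ , _ , r≤n , _)      = contradiction r≤n (<⇒≱ n<r)
  from : ∀ {Q} → Q ∈ˡ map addSingleton (rPartitions r n m) → Q ∈ˡ rPartitions r (suc n) (suc m)
  from Q∈ with P , P∈ , refl ← ∈-map⁻ addSingleton Q∈ = ∈-rPartitions⁺ (addSingleton⁺ (∈-rPartitions⁻ P∈))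

-- The last element either forms a new block or joins any one of the `suc m` blocks present.
rStirling₂-≥ : ∀ r n m → r ≤ n →
               rStirling₂ r (suc n) (suc m) ≡ rStirling₂ r n m + rStirling₂ r n (suc m) * suc m
rStirling₂-≥ r n m r≤n = begin
  length (rPartitions r (suc n) (suc m))
    ≡⟨ unique⇒length (rPartitions-unique r (suc n) (suc m)) unique to from ⟩
  length (singletons ++ inserted)
    ≡⟨ List.length-++ singletons ⟩
  length singletons + length inserted
    ≡⟨ cong₂ _+_ (List.length-map addSingleton (rPartitions r n m))
         (length-concatMap {f = insertions} {xs = rPartitions r n (suc m)} (All.tabulate λ {P} P∈ →
           trans (length-insertions P) (proj₁ (proj₂ (proj₂ (∈-rPartitions⁻ P∈)))))) ⟩
  rStirling₂ r n m + rStirling₂ r n (suc m) * suc m ∎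
  where
  open ≡-Reasoning
  singletons = map addSingleton (rPartitions r n m)
  inserted = concatMap insertions (rPartitions r n (suc m))

  ∈-inserted⁻ : ∀ {Q} → Q ∈ˡ inserted → ∃ λ P → SortedRPartition r (suc m) P × Marks inside P Q
  ∈-inserted⁻ Q∈ with P , P∈ , Q∈P ← find (∈-concatMap⁻ insertions {xs = rPartitions r n (suc m)} Q∈) =
    P , ∈-rPartitions⁻ P∈ , ∈-insertions⁻ Q∈P

  to : ∀ {Q} → Q ∈ˡ rPartitions r (suc n) (suc m) → Q ∈ˡ singletons ++ inserted
  to Q∈ with rPartition-cases (∈-rPartitions⁻ Q∈)
  ... | inj₁ (P , valid , refl)  = ∈-++⁺ˡ (∈-map⁺ addSingleton (∈-rPartitions⁺ valid))
  ... | inj₂ (P , valid , _ , m) =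
    ∈-++⁺ʳ singletons (∈-concatMap⁺ insertions (lose (∈-rPartitions⁺ valid) (∈-insertions⁺ m)))

  from : ∀ {Q} → Q ∈ˡ singletons ++ inserted → Q ∈ˡ rPartitions r (suc n) (suc m)
  from Q∈ with ∈-++⁻ singletons Q∈
  ... | inj₁ Q∈′ with P , P∈ , refl ← ∈-map⁻ addSingleton Q∈′ =
    ∈-rPartitions⁺ (addSingleton⁺ (∈-rPartitions⁻ P∈))
  ... | inj₂ Q∈′ with P , valid , m ← ∈-inserted⁻ Q∈′ = ∈-rPartitions⁺ (marks-inside⁺ r≤n m valid)

  disjoint : ∀ {Q} → ¬ (Q ∈ˡ singletons × Q ∈ˡ inserted)
  -- Since `Q` determines the family it marks, an overlap would make `∅` a block of a partition.
  disjoint (Q∈ , Q∈′) with P , _ , refl ← ∈-map⁻ addSingleton Q∈ | P′ , (_ , (nonempty , _) , _) , m ← ∈-inserted⁻ Q∈′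
    with refl ← marks-functional m (marks-addSingleton P) | (_ , x∈∅) ∷ _ ← nonempty = ∉⊥ x∈∅

  unique : Unique (singletons ++ inserted)
  unique = Unique.++⁺ (Unique.map⁺ addSingleton-injective (rPartitions-unique r n m))
    (concatMap-unique insertions-unique
      (λ Q∈P Q∈P′ → marks-functional (∈-insertions⁻ Q∈P) (∈-insertions⁻ Q∈P′))
      (rPartitions-unique r n (suc m)))
    disjoint

-- Boundary values of the r-Stirling numbers

rStirling₂-suc-0 : ∀ r n → rStirling₂ r (suc n) 0 ≡ 0
rStirling₂-suc-0 r n with rPartitions r (suc n) 0 in eq
... | []    = refl
... | P ∷ _ with ∈-rPartitions⁻ {P = P} {r = r} (subst (P ∈ˡ_) (sym eq) (here refl))
rStirling₂-suc-0 r n | [] ∷ _ | _ , (_ , _ , covers) , _ with () ← covers zero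
rStirling₂-suc-0 r n | (_ ∷ _) ∷ _ | _ , _ , () , _

rStirling₂-0-0 : ∀ r → rStirling₂ r 0 0 ≡ 1
rStirling₂-0-0 r = refl

rStirling₂-0-suc : ∀ r m → rStirling₂ r 0 (suc m) ≡ 0
rStirling₂-0-suc r m = refl

-- While `n ≤ r` the partition into singletons is the only one, as each new element opens a block.
rStirling₂-diag : ∀ r n → n ≤ r → rStirling₂ r n n ≡ 1
rStirling₂-diag r zero    _   = rStirling₂-0-0 r
rStirling₂-diag r (suc n) n<r = trans (rStirling₂-< r n n n<r) (rStirling₂-diag r n (<⇒≤ n<r))

rStirling₂-off-diag : ∀ r n m → n ≤ r → m ≢ n → rStirling₂ r n m ≡ 0
rStirling₂-off-diag r zero    zero    _   m≢n = contradiction refl m≢n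
rStirling₂-off-diag r zero    (suc m) _   _   = rStirling₂-0-suc r m
rStirling₂-off-diag r (suc n) zero    _   _   = rStirling₂-suc-0 r n
rStirling₂-off-diag r (suc n) (suc m) n<r m≢n =
  trans (rStirling₂-< r n m n<r) (rStirling₂-off-diag r n m (<⇒≤ n<r) (m≢n ∘ cong suc))

rStirling₂-few : ∀ r n m → m < r → rStirling₂ r (n + r) m ≡ 0
rStirling₂-few r zero    m       m<r = rStirling₂-off-diag r r m ≤-refl (<⇒≢ m<r)
rStirling₂-few r (suc n) zero    _   = rStirling₂-suc-0 r (n + r)
rStirling₂-few r (suc n) (suc m) m<r
  rewrite rStirling₂-≥ r (n + r) m (m≤n+m r n)
        | rStirling₂-few r n m (<⇒≤ m<r) | rStirling₂-few r n (suc m) m<r = refl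

rStirling₂-many : ∀ r n m → n + r < m → rStirling₂ r (n + r) m ≡ 0
rStirling₂-many r zero    m       r<m = rStirling₂-off-diag r r m ≤-refl (≢-sym (<⇒≢ r<m))
rStirling₂-many r (suc n) (suc m) n<m
  rewrite rStirling₂-≥ r (n + r) m (m≤n+m r n)
        | rStirling₂-many r n m (s≤s⁻¹ n<m) | rStirling₂-many r n (suc m) (<⇒≤ n<m) = refl

-- Opening a block to reach `r` would start from `r - 1` blocks, too few for `r` separated elements.
-- Only the joining term of the recurrence remains.
rStirling₂-least : ∀ r n → 1 ≤ r → rStirling₂ r (suc n + r) r ≡ rStirling₂ r (n + r) r * r
rStirling₂-least r@(suc r-1) n _
  rewrite rStirling₂-≥ r (n + r) r-1 (m≤n+m r n) | rStirling₂-few r n r-1 (n<1+n r-1) = refl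

-- Fubini numbers as iterates of an operator on weights

∑ : ℕ → (ℕ → ℕ) → ℕ
∑ n f = sum (applyUpTo f n)

∑-cong : ∀ n {f g} → f ≗ g → ∑ n f ≡ ∑ n g
∑-cong zero    f≗g = refl
∑-cong (suc n) f≗g = cong₂ _+_ (f≗g 0) (∑-cong n (f≗g ∘ suc))

∑-+ : ∀ n f g → ∑ n (λ k → f k + g k) ≡ ∑ n f + ∑ n g
∑-+ zero    f g = refl
∑-+ (suc n) f g rewrite ∑-+ n (f ∘ suc) (g ∘ suc) =
  +-*-Solver.solve 4 (λ a b c d → (a :+ b) :+ (c :+ d) := (a :+ c) :+ (b :+ d)) refl (f 0) (g 0) _ _
  where open +-*-Solver using (_:+_; _:=_)

∑-last : ∀ n f → ∑ (suc n) f ≡ ∑ n f + f n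
∑-last n f = begin
  ∑ (suc n) f                          ≡⟨ cong sum (List.applyUpTo-∷ʳ f n) ⟨
  sum (applyUpTo f n ++ [ f n ]) ≡⟨ sum-++ (applyUpTo f n) _ ⟩
  ∑ n f + (f n + 0)                    ≡⟨ cong (∑ n f +_) (+-identityʳ (f n)) ⟩
  ∑ n f + f n                          ∎
  where open ≡-Reasoning

-- Effect on a weight w of the number of blocks of one more element: it joins
-- one of the k blocks present or opens a new one.
step : (ℕ → ℕ) → ℕ → ℕ
step w k = k * w k + w (suc k)

steps : ℕ → (ℕ → ℕ) → ℕ → ℕ
steps zero    w = w
steps (suc n) w = step (steps n w)

steps-step : ∀ n w → steps n (step w) ≗ step (steps n w)
steps-step zero    w k = refl
steps-step (suc n) w k = cong₂ (λ a b → k * a + b) (steps-step n w k) (steps-step n w (suc k))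

-- The total weight of all r-partitions of `n + r` elements, where one with `j` blocks weighs `w j`.
-- The weight `_!` gives the r-Fubini number.
weighted : ℕ → ℕ → (ℕ → ℕ) → ℕ
weighted r n w = ∑ (suc n) (λ k → w (k + r) * rStirling₂ r (n + r) (k + r))

-- This transposes the Stirling recurrence: instead of counting partitions with one more element,
-- the weight is averaged over nothing but summed over the choices for that element, which is
-- `step w`.
weighted-suc : ∀ r n w → 1 ≤ r → weighted r (suc n) w ≡ weighted r n (step w)
weighted-suc r n w 1≤r = begin
  w r * rStirling₂ r (suc n + r) r + ∑ (suc n) (λ k → w (suc k + r) * rStirling₂ r (suc n + r) (suc k + r))
    ≡⟨ cong₂ _+_ first (∑-cong (suc n) rest) ⟩
  A 0 + ∑ (suc n) (λ k → A (suc k) + B k)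
    ≡⟨ cong (A 0 +_) (∑-+ (suc n) (A ∘ suc) B) ⟩
  A 0 + (∑ (suc n) (A ∘ suc) + ∑ (suc n) B)
    ≡⟨ +-assoc (A 0) _ _ ⟨
  ∑ (suc (suc n)) A + ∑ (suc n) B
    ≡⟨ cong (_+ ∑ (suc n) B) (∑-last (suc n) A) ⟩
  ∑ (suc n) A + A (suc n) + ∑ (suc n) B
    ≡⟨ cong (λ z → ∑ (suc n) A + z + ∑ (suc n) B) A-last ⟩
  ∑ (suc n) A + 0 + ∑ (suc n) B
    ≡⟨ cong (_+ ∑ (suc n) B) (+-identityʳ (∑ (suc n) A)) ⟩
  ∑ (suc n) A + ∑ (suc n) B
    ≡⟨ ∑-+ (suc n) A B ⟨
  ∑ (suc n) (λ k → A k + B k)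
    ≡⟨ ∑-cong (suc n) (λ k → sym (*-distribʳ-+ (T k) ((k + r) * w (k + r)) (w (suc k + r)))) ⟩
  weighted r n (step w) ∎
  where
  open ≡-Reasoning
  open +-*-Solver using (_:+_; _:*_; _:=_)
  T A B : ℕ → ℕ
  T k = rStirling₂ r (n + r) (k + r)
  -- Of the partitions with `k + r` blocks, `A` collects the extensions where the new element joins
  -- a block and `B` those where it opens one.
  A k = (k + r) * w (k + r) * T k
  B k = w (suc k + r) * T k

  first : w r * rStirling₂ r (suc n + r) r ≡ A 0
  first rewrite rStirling₂-least r n 1≤r =
    +-*-Solver.solve 3 (λ x t s → x :* (t :* s) := s :* x :* t) refl (w r) (T 0) r

  rest : ∀ k → w (suc k + r) * rStirling₂ r (suc n + r) (suc k + r) ≡ A (suc k) + B k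
  rest k rewrite rStirling₂-≥ r (n + r) (k + r) (m≤n+m r n) =
    +-*-Solver.solve 4 (λ x t t′ s → x :* (t :+ t′ :* s) := s :* x :* t′ :+ x :* t) refl
      (w (suc k + r)) (T k) (T (suc k)) (suc k + r)

  A-last : A (suc n) ≡ 0
  -- There are no `suc n + r` nonempty blocks on `n + r` elements.
  A-last rewrite rStirling₂-many r n (suc n + r) ≤-refl = *-zeroʳ ((suc n + r) * w (suc n + r))

weighted≡steps : ∀ r n w → 1 ≤ r → weighted r n w ≡ steps n w r
weighted≡steps r zero w 1≤r rewrite rStirling₂-diag r r ≤-refl =
  trans (+-identityʳ _) (*-identityʳ (w r))
weighted≡steps r (suc n) w 1≤r = begin
  weighted r (suc n) w   ≡⟨ weighted-suc r n w 1≤r ⟩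
  weighted r n (step w)  ≡⟨ weighted≡steps r n (step w) 1≤r ⟩
  steps n (step w) r     ≡⟨ steps-step n w r ⟩
  steps (suc n) w r      ∎
  where open ≡-Reasoning

rFubini≡steps : ∀ n r → 1 ≤ r → rFubini n r ≡ steps n _! r
rFubini≡steps n r 1≤r = trans
  (cong sum (List.map-upTo (λ k → (k + r) ! * rStirling₂ r (n + r) (k + r)) (suc n)))
  (weighted≡steps r n _! 1≤r)

-- Congruences modulo powers of 2

-- `step` is linear, so the difference of its values is a combination of differences at `k` and
-- `suc k`. It never looks below `k`, so the bound `c` is kept.
step-mod : ∀ {d c f g} → (∀ k → c ≤ k → f k ≡ g k [mod d ]) →
           ∀ k → c ≤ k → step f k ≡ step g k [mod d ]
step-mod {d} {f = f} {g} f≡g k c≤k = ℤ.∣⇒∣ᵤ (subst (ℤ.+ d ℤ.∣_) (sym eq)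
  (ℤ.∣m∣n⇒∣m+n (ℤ.∣n⇒∣m*n (ℤ.+ k) (ℤ.∣ᵤ⇒∣ (f≡g k c≤k))) (ℤ.∣ᵤ⇒∣ (f≡g (suc k) (m≤n⇒m≤1+n c≤k)))))
  where
  identity : ∀ s a b a′ b′ → (s ℤ.* a ℤ.+ b) ℤ.- (s ℤ.* a′ ℤ.+ b′) ≡ s ℤ.* (a ℤ.- a′) ℤ.+ (b ℤ.- b′)
  identity = solve-∀
  pos-step : ∀ h → ℤ.+ step h k ≡ ℤ.+ k ℤ.* ℤ.+ h k ℤ.+ ℤ.+ h (suc k)
  pos-step h = trans (ℤ.pos-+ (k * h k) (h (suc k))) (cong (ℤ._+ ℤ.+ h (suc k)) (ℤ.pos-* k (h k)))
  eq : ℤ.+ step f k ℤ.- ℤ.+ step g k ≡ ℤ.+ k ℤ.* (ℤ.+ f k ℤ.- ℤ.+ g k) ℤ.+ (ℤ.+ f (suc k) ℤ.- ℤ.+ g (suc k))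
  eq = trans (cong₂ ℤ._-_ (pos-step f) (pos-step g)) (identity (ℤ.+ k) (ℤ.+ f k) (ℤ.+ f (suc k)) (ℤ.+ g k) (ℤ.+ g (suc k)))

steps-mod : ∀ {d c i j w} → (∀ k → c ≤ k → steps i w k ≡ steps j w k [mod d ]) →
            ∀ l k → c ≤ k → steps (l + i) w k ≡ steps (l + j) w k [mod d ]
steps-mod base zero    = base
steps-mod base (suc l) = step-mod (steps-mod base l)

steps-∣ : ∀ {d c w} → (∀ k → c ≤ k → d ∣ w k) → ∀ n k → c ≤ k → d ∣ steps n w k
steps-∣ d∣w zero    k c≤k = d∣w k c≤k
steps-∣ d∣w (suc n) k c≤k =
  ∣m∣n⇒∣m+n (∣n⇒∣m*n k (steps-∣ d∣w n k c≤k)) (steps-∣ d∣w n (suc k) (m≤n⇒m≤1+n c≤k))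

∣⇒mod : ∀ {d a b} → d ∣ a → d ∣ b → a ≡ b [mod d ]
∣⇒mod {d} {a} {b} d∣a d∣b = ℤ.∣⇒∣ᵤ (ℤ.∣m∣n⇒∣m-n {ℤ.+ d} {ℤ.+ a} {ℤ.+ b} (ℤ.∣ᵤ⇒∣ d∣a) (ℤ.∣ᵤ⇒∣ d∣b))

-- The initial congruence and the periodicity

-- Evaluation of 24 cases: `i` encodes the exponents 3 to 6 and `j` the arguments 2 to 7.
steps-!-small : (i : Fin 4) (j : Fin 6) → let m = 3 + toℕ i; k = 2 + toℕ j in
                steps (suc m) _! k ≡ steps (m ∸ 1) _! k [mod 2 ^ m ]
-- Integer divisibility unfolds to divisibility of absolute values, which `_∣?_` on naturals
-- decides.
steps-!-small = toWitness {a? = all? λ i → all? λ j → _ ∣? _} tt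

-- The power of 2 in `8 !` is `2 ^ 7`, enough for every exponent up to 6.
2^m∣8! : (i : Fin 4) → 2 ^ (3 + toℕ i) ∣ 8 !
2^m∣8! = toWitness {a? = all? λ i → _ ∣? _} tt

steps-!-base : (i : Fin 4) → let m = 3 + toℕ i in
               ∀ k → 2 ≤ k → steps (suc m) _! k ≡ steps (m ∸ 1) _! k [mod 2 ^ m ]
steps-!-base i k 2≤k with 8 ≤? k
... | yes 8≤k = ∣⇒mod {2 ^ (3 + toℕ i)} (steps-∣ d∣ (4 + toℕ i) k 8≤k) (steps-∣ d∣ (2 + toℕ i) k 8≤k)
  where
  d∣ : ∀ k → 8 ≤ k → 2 ^ (3 + toℕ i) ∣ k !
  d∣ k 8≤k = ∣-trans (2^m∣8! i) (m≤n⇒m!∣n! 8≤k)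
... | no 8≰k = subst (λ k → steps (4 + toℕ i) _! k ≡ steps (2 + toℕ i) _! k [mod 2 ^ (3 + toℕ i) ])
  (trans (cong (_+_ 2) (toℕ-fromℕ< k-2<6)) (m+[n∸m]≡n 2≤k)) (steps-!-small i (fromℕ< k-2<6))
  where
  k-2<6 : k ∸ 2 < 6
  k-2<6 = ∸-monoˡ-< (≰⇒> 8≰k) 2≤k

theorem4p6 : (r m : ℕ) → 2 ≤ r → 3 ≤ m → m ≤ 6 → (n : ℕ) → m ∸ 1 ≤ n → rFubini (n + 2) r ≡ rFubini n r [mod 2 ^ m ]
theorem4p6 r m 2≤r 3≤m m≤6 n m-1≤n
  rewrite rFubini≡steps (n + 2) r (<⇒≤ 2≤r) | rFubini≡steps n r (<⇒≤ 2≤r) =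
  -- Both sides of the initial congruence, at `suc m` and `m ∸ 1` iterations, are advanced by the
  -- same `n ∸ (m ∸ 1)` further iterations.
  subst₂ (λ a b → steps a _! r ≡ steps b _! r [mod 2 ^ m ]) n+2≡ (m∸n+n≡m m-1≤n)
    (steps-mod {2 ^ m} base (n ∸ (m ∸ 1)) r 2≤r)
  where
  m-3<4 : m ∸ 3 < 4
  m-3<4 = ∸-monoˡ-< (s≤s m≤6) 3≤m
  base : ∀ k → 2 ≤ k → steps (suc m) _! k ≡ steps (m ∸ 1) _! k [mod 2 ^ m ]
  base = subst (λ m → ∀ k → 2 ≤ k → steps (suc m) _! k ≡ steps (m ∸ 1) _! k [mod 2 ^ m ])
    (trans (cong (_+_ 3) (toℕ-fromℕ< m-3<4)) (m+[n∸m]≡n 3≤m)) (steps-!-base (fromℕ< m-3<4))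
  n+2≡ : n ∸ (m ∸ 1) + suc m ≡ n + 2
  n+2≡ = begin
    n ∸ (m ∸ 1) + suc m         ≡⟨ cong (λ z → n ∸ (m ∸ 1) + suc z) (m∸n+n≡m (≤-trans (s≤s z≤n) 3≤m)) ⟨
    n ∸ (m ∸ 1) + suc (m ∸ 1 + 1) ≡⟨ cong (n ∸ (m ∸ 1) +_) (+-suc (m ∸ 1) 1) ⟨
    n ∸ (m ∸ 1) + (m ∸ 1 + 2)   ≡⟨ +-assoc (n ∸ (m ∸ 1)) (m ∸ 1) 2 ⟨
    n ∸ (m ∸ 1) + (m ∸ 1) + 2   ≡⟨ cong (_+ 2) (m∸n+n≡m m-1≤n) ⟩
    n + 2                       ∎
    where open ≡-Reasoning
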